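{- Let $d \geq 2$ be an integer and let $T$ be a tree of order $n$. Then $$\gamma_d^2(T) \leq \frac{n-2\sqrt{n}+d+1}{d}.$$
   Context: $\gamma_d^2(T)$ is the minimum size of a set $X\subseteq V(T)$ such that every vertex of $V(T)\setminus X$ is at distance at most $d$ from some vertex of $X$, and any two distinct vertices of $X$ are at distance at least $3$ in $T$. -}

module Defs where

open import Data.Nat using (ℕ; zero; suc; _≤_; _<_)
open import Data.Fin using (Fin)
open import Data.Fin.Subset using (Subset; _∈_; _∉_; ∣_∣)
open import Data.List using (List; []; _∷_)
open import Data.List.Relation.Unary.Unique.Propositional using (Unique)
open import Data.Product using (Σ; ∃; _×_; _,_)
open import Relation.Binary.PropositionalEquality using (_≡_)
open import Relation.Nullary using (¬_)

record Graph (n : ℕ) : Set₁ where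
  field
    Adj    : Fin n → Fin n → Set
    sym    : ∀ {u v} → Adj u v → Adj v u
    irrefl : ∀ {u} → ¬ Adj u u
open Graph public

data Walk {n : ℕ} (G : Graph n) : Fin n → Fin n → Set where
  []  : ∀ {u} → Walk G u u
  _∷_ : ∀ {u v w} → Adj G u v → Walk G v w → Walk G u w

len : ∀ {n} {G : Graph n} {u v} → Walk G u v → ℕ
len []      = zero
len (_ ∷ w) = suc (len w)

verts : ∀ {n} {G : Graph n} {u v} → Walk G u v → List (Fin n)
verts {u = u} []      = u ∷ []
verts {u = u} (_ ∷ w) = u ∷ verts w

IsPath : ∀ {n} {G : Graph n} {u v} → Walk G u v → Set
IsPath w = Unique (verts w)

Connected : ∀ {n} → Graph n → Set
Connected G = ∀ u v → Walk G u v

HasCycle : ∀ {n} → Graph n → Set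
HasCycle G = Σ _ λ u → Σ _ λ v → Adj G u v × Σ (Walk G v u) λ p → IsPath p × 2 ≤ len p

Acyclic : ∀ {n} → Graph n → Set
Acyclic G = ¬ HasCycle G

IsTree : ∀ {n} → Graph n → Set
IsTree {n} G = 1 ≤ n × Connected G × Acyclic G

DistLE : ∀ {n} → Graph n → Fin n → Fin n → ℕ → Set
DistLE G u v k = Σ (Walk G u v) λ p → len p ≤ k

DistGE : ∀ {n} → Graph n → Fin n → Fin n → ℕ → Set
DistGE G u v k = ∀ (p : Walk G u v) → k ≤ len p

-- X is a distance-d dominating set that is a 2-packing
-- (distinct vertices of X are at distance ≥ 3)
IsD2Set : ∀ {n} → Graph n → ℕ → Subset n → Set
IsD2Set {n} G d X =
  (∀ v → v ∉ X → Σ (Fin n) λ x → x ∈ X × DistLE G v x d) ×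
  (∀ x y → x ∈ X → y ∈ X → ¬ x ≡ y → DistGE G x y 3)

IsGammaD2 : ∀ {n} → Graph n → ℕ → ℕ → Set
IsGammaD2 {n} G d γ =
  (Σ (Subset n) λ X → IsD2Set G d X × ∣ X ∣ ≡ γ) ×
  (∀ X → IsD2Set G d X → γ ≤ ∣ X ∣)

{-# OPTIONS --safe #-}

-- Call a d-dominating set whose members are pairwise at distance at least 3 a (d,2)-set, and cut the
-- tree along edges as long as both sides keep more than d vertices. Each of the K final pieces ("clusters")
-- has a centre p all of whose branches have at most d vertices. Let j be the number of branches with
-- exactly d vertices (but at least 1); the cluster has at least d j + 1 vertices. Two facts drive the proof.
--  * A cluster is dominated by its centre alone.
--  * If a packing is already chosen on the far side of an edge leaving the cluster, it extends to dominate
--    the cluster using at most j more vertices: the centre if it is far enough from the packing, and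
--    otherwise essentially one vertex in each branch with d vertices.
-- So start from a cluster with the largest j, say q, at cost 1, and attach the others one by one: this
-- gives a (d,2)-set of size at most J - (q - 1), where J is the sum of the j's. With n ≥ d J + K and
-- J ≤ q K, the bound follows from 4 d q (K - 1) ≤ (d q + (K - 1))².

module Submission where

open import Defs
open import Data.Nat using (ℕ; zero; suc; _⊔_; _≤_; _<_; z≤n; s≤s; s≤s⁻¹; _≟_; _≤?_; _<?_)
open import Data.Nat.Properties
open import Data.Nat.Solver using (module +-*-Solver)
import Data.Nat as ℕ
open import Data.Fin using (Fin)
import Data.Fin as Fin
import Data.Fin.Properties as Fin
open import Data.Fin.Subset using (Subset; _∈_; _∉_; _⊆_; ∣_∣; _∩_; _─_; ⁅_⁆; inside; outside)
import Data.Fin.Subset as Subset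
open import Data.Fin.Subset.Properties using (_∈?_; nonempty?; p⊆q⇒∣p∣≤∣q∣; p⊂q⇒∣p∣<∣q∣; x∈p∩q⁺; x∈p∩q⁻; x∈p∧x∉q⇒x∈p─q; x∈p∧x≢y⇒x∈p-y; x∈p⇒∣p-x∣<∣p∣; ∣⁅x⁆∣≡1; x∈⁅x⁆; x∈⁅y⁆⇒x≡y; p─q⊆p; p─q─q≡p─q; ∣p∩q∣≤∣q∣; ∣p∣≤n; ∣⊤∣≡n; ∣⊥∣≡0; ∈⊤)
open import Data.Vec using ([]; _∷_; tabulate)
open import Data.Vec.Properties using (lookup∘tabulate; []=⇒lookup; lookup⇒[]=)
open import Data.List using (List; []; _∷_; _++_; map; filter; length; allFin)
open import Data.List.Properties using (length-++; length-map; length-filter)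
open import Data.List.Relation.Unary.All as All using ([]; _∷_)
open import Data.List.Relation.Unary.Any using (here; there; any?)
open import Data.List.Relation.Unary.AllPairs using ([]; _∷_)
open import Data.List.Relation.Unary.Unique.Propositional using (Unique)
import Data.List.Relation.Unary.Unique.Propositional.Properties as Unique
open import Data.List.Membership.Propositional using (find; lose) renaming (_∈_ to _∈ˡ_)
open import Data.List.Membership.Propositional.Properties using (∈-++⁺ˡ; ∈-++⁺ʳ; ∈-++⁻; ∈-map⁺; ∈-map⁻; ∈-filter⁺; ∈-filter⁻; ∈-allFin)
open import Data.Product using (Σ; ∃; _×_; _,_; proj₁; proj₂)
open import Data.Sum using (_⊎_; inj₁; inj₂)
open import Data.Unit using (⊤; tt)
open import Data.Empty using (⊥-elim)
open import Function using (_∘_; case_of_)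
open import Relation.Nullary using (¬_; yes; no; does; ¬?)
open import Relation.Nullary.Decidable using (_×-dec_; dec-true; toSum)
open import Relation.Unary using (Decidable)
open import Relation.Binary.PropositionalEquality using (_≡_; _≢_; refl; trans; cong; cong₂; subst; ≢-sym) renaming (sym to ≡-sym)

-- In this module _+_ and _*_ are those of ℕ and _-_ removes a point from a subset; after it all three are those of ℤ.
module Combinatorics where

  open import Data.Nat using (_+_; _*_)
  open import Data.Fin.Subset using (_-_)
  open +-*-Solver using (solve; con; _:+_; _:*_; _:=_)

  -- Axioms for the distance of a tree.

  ≡suc-asym : ∀ {m k} → m ≡ suc k → k ≢ suc m
  ≡suc-asym refl ()

  -- The combinatorial part uses only these properties. `δ-edge` is bipartiteness: the ends of an
  -- edge are never equidistant from a vertex. `δ-cross` says that every edge is a bridge, so a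
  -- geodesic between its sides passes through it.
  record TreeMetric (n : ℕ) : Set where
    field
      δ      : Fin n → Fin n → ℕ
      δ-refl : ∀ u → δ u u ≡ 0
      δ-zero : ∀ {u v} → δ u v ≡ 0 → u ≡ v
      δ-sym  : ∀ u v → δ u v ≡ δ v u
      δ-tri  : ∀ u v w → δ u w ≤ δ u v + δ v w
      δ-step : ∀ {u w} → u ≢ w → ∃ λ v → δ u v ≡ 1 × δ u w ≡ suc (δ v w)
      δ-edge : ∀ {u v} → δ u v ≡ 1 → ∀ s → δ v s ≡ suc (δ u s) ⊎ δ u s ≡ suc (δ v s)
      δ-cross : ∀ {u v s t} → δ u v ≡ 1 → δ v s ≡ suc (δ u s) → δ u t ≡ suc (δ v t) →
                δ s t ≡ δ u s + suc (δ v t)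

  -- Reduced walks in an acyclic graph and the distance they define.

  module FromTree {n : ℕ} (G : Graph n) (connected : Connected G) (acyclic : Acyclic G) where

    adj⇒≢ : ∀ {u v} → Adj G u v → v ≢ u
    adj⇒≢ e refl = irrefl G e

    -- Reduced f w: w never backtracks, and its first step does not lead to f.
    Reduced : ∀ {u v} → Fin n → Walk G u v → Set
    Reduced f []                    = ⊤
    Reduced f (_∷_ {u} {v} {w} e p) = v ≢ f × Reduced u p

    reduced-free : ∀ {u v f} (w : Walk G u v) → Reduced f w → Reduced u w
    reduced-free []      _       = tt
    reduced-free (e ∷ w) (_ , r) = adj⇒≢ e , r

    prefix-to : ∀ {u v x} (w : Walk G u v) → IsPath w → x ∈ˡ verts w →
                Σ (Walk G u x) λ p → IsPath p × (∀ {y} → y ∈ˡ verts p → y ∈ˡ verts w)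
    prefix-to []      _       (here refl) = [] , [] ∷ [] , λ m → m
    prefix-to (e ∷ w) _       (here refl) = [] , [] ∷ [] , λ { (here q) → here q }
    prefix-to (e ∷ w) (a ∷ u) (there m)   with prefix-to w u m
    ... | p , path , sub = e ∷ p , All.tabulate (λ y∈ → All.lookup a (sub y∈)) ∷ path ,
                           λ { (here q) → here q ; (there y∈) → there (sub y∈) }

    last∈ : ∀ {u v} (w : Walk G u v) → v ∈ˡ verts w
    last∈ []      = here refl
    last∈ (e ∷ w) = there (last∈ w)

    reduced⇒path : ∀ {u v f} (w : Walk G u v) → Reduced f w → IsPath w
    -- A return to `u` would close a cycle: the edge `e` followed by the part of `w` up to `u`.
    -- `Reduced u w` rules out the immediate return, so that part has length at least 2.
    fresh : ∀ {u v t} → Adj G u v → (w : Walk G v t) → Reduced u w → IsPath w → ¬ u ∈ˡ verts w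

    reduced⇒path []      _       = [] ∷ []
    reduced⇒path (e ∷ w) (_ , r) =
      All.tabulate (λ { y∈ refl → fresh e w r (reduced⇒path w r) y∈ }) ∷ reduced⇒path w r

    fresh e []       r path (here refl) = irrefl G e
    fresh e (e′ ∷ w) r path (here refl) = irrefl G e
    fresh e (e′ ∷ w) (≢u , r) (a ∷ path) (there u∈) with prefix-to w path u∈
    ... | []     , _     , _   = ≢u refl
    ... | f ∷ p  , path′ , sub =
      acyclic (_ , _ , e , e′ ∷ f ∷ p , All.tabulate (λ y∈ → All.lookup a (sub y∈)) ∷ path′ , s≤s (s≤s z≤n))

    closed-reduced-trivial : ∀ {u v f} (e : Adj G u v) (w : Walk G v u) → ¬ Reduced f (e ∷ w)
    closed-reduced-trivial e w (_ , r) = fresh e w r (reduced⇒path w r) (last∈ w)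

    revApp : ∀ {a s t} → Walk G a s → Walk G a t → Walk G s t
    revApp []      acc = acc
    revApp (e ∷ w) acc = revApp w (Graph.sym G e ∷ acc)

    len-revApp : ∀ {a s t} (w : Walk G a s) (acc : Walk G a t) → len (revApp w acc) ≡ len w + len acc
    len-revApp []      acc = refl
    len-revApp (e ∷ w) acc = trans (len-revApp w _) (+-suc (len w) (len acc))

    -- The only new turn is at `a`, and it is no backtracking because `w` does not start towards
    -- `b`.
    revApp-reduced : ∀ {a b s t} (w : Walk G a s) (e : Adj G a b) (acc : Walk G b t) →
                     Reduced b w → Reduced a acc → Reduced s (revApp w (e ∷ acc))
    revApp-reduced []       e acc _        r′ = adj⇒≢ e , r′
    revApp-reduced (e₁ ∷ w) e acc (≢b , r) r′ =
      revApp-reduced w (Graph.sym G e₁) (e ∷ acc) r (≢-sym ≢b , r′)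

    revApp-∷-nonempty : ∀ {a b s t} (w : Walk G a s) (e : Adj G a b) (acc : Walk G b t) →
      ∃ λ c → Σ (Adj G s c) λ e′ → Σ (Walk G c t) λ w′ → revApp w (e ∷ acc) ≡ e′ ∷ w′
    revApp-∷-nonempty []       e acc = _ , e , acc , refl
    revApp-∷-nonempty (e₁ ∷ w) e acc = revApp-∷-nonempty w (Graph.sym G e₁) (e ∷ acc)

    -- Where the two walks diverge, the reverse of one followed by the other would be a closed
    -- reduced walk with at least one edge.
    reduced-len-unique : ∀ {u t f f′} (w w′ : Walk G u t) → Reduced f w → Reduced f′ w′ → len w ≡ len w′
    reduced-len-unique []      []       _  _  = refl
    reduced-len-unique []      (e ∷ w′) _  r′ = ⊥-elim (closed-reduced-trivial e w′ r′)
    reduced-len-unique (e ∷ w) []       r  _  = ⊥-elim (closed-reduced-trivial e w r)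
    reduced-len-unique (_∷_ {v = a} e w) (_∷_ {v = b} e′ w′) (_ , r) (_ , r′) with a Fin.≟ b
    ... | yes refl = cong suc (reduced-len-unique w w′ r r′)
    ... | no  a≢b  with revApp-∷-nonempty (e ∷ w) e′ w′ | revApp-reduced (e ∷ w) e′ w′ (a≢b , r) r′
    ...   | _ , e″ , w″ , eq | red = ⊥-elim (closed-reduced-trivial e″ w″ (subst (Reduced _) eq red))

    reduce : ∀ {u v} (w : Walk G u v) → Σ (Walk G u v) λ r → Reduced u r × len r ≤ len w
    reduce [] = [] , tt , z≤n
    reduce (_∷_ {u} e w) with reduce w
    ... | [] , _ , le = e ∷ [] , (adj⇒≢ e , tt) , s≤s z≤n
    ... | _∷_ {v = x} e′ r , (_ , red) , le with x Fin.≟ u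
    ...   | yes refl = r , reduced-free r red , ≤-trans (n≤1+n _) (≤-trans le (n≤1+n _))
    ...   | no  x≢u  = e ∷ e′ ∷ r , (adj⇒≢ e , x≢u , red) , s≤s le

    geo : ∀ u v → Walk G u v
    geo u v = proj₁ (reduce (connected u v))

    geo-reduced : ∀ u v → Reduced u (geo u v)
    geo-reduced u v = proj₁ (proj₂ (reduce (connected u v)))

    dist : Fin n → Fin n → ℕ
    dist u v = len (geo u v)

    reduced-dist : ∀ {u v f} (w : Walk G u v) → Reduced f w → len w ≡ dist u v
    reduced-dist w r = reduced-len-unique w (geo _ _) r (geo-reduced _ _)

    dist-min : ∀ {u v} (w : Walk G u v) → dist u v ≤ len w
    dist-min w with reduce w
    ... | r , red , le = ≤-trans (≤-reflexive (≡-sym (reduced-dist r red))) le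

    dist-sym-≤ : ∀ u v → dist v u ≤ dist u v
    dist-sym-≤ u v = ≤-trans (dist-min (revApp (geo u v) []))
      (≤-reflexive (trans (len-revApp (geo u v) []) (+-comm (dist u v) 0)))

    dist-sym : ∀ u v → dist u v ≡ dist v u
    dist-sym u v = ≤-antisym (dist-sym-≤ v u) (dist-sym-≤ u v)

    dist-tri : ∀ u v w → dist u w ≤ dist u v + dist v w
    dist-tri u v w = ≤-trans (dist-min (revApp (geo v u) (geo v w)))
      (≤-reflexive (trans (len-revApp (geo v u) (geo v w)) (cong (_+ dist v w) (dist-sym v u))))

    walk₀ : ∀ {u v} (w : Walk G u v) → len w ≡ 0 → u ≡ v
    walk₀ [] _ = refl

    walk₁ : ∀ {u v} (w : Walk G u v) → len w ≡ 1 → Adj G u v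
    walk₁ (e ∷ []) _ = e

    adj : ∀ {u v} → dist u v ≡ 1 → Adj G u v
    adj = walk₁ (geo _ _)

    dist-adj : ∀ {u v} → Adj G u v → dist u v ≡ 1
    dist-adj {u} e = ≡-sym (reduced-dist {f = u} (e ∷ []) (adj⇒≢ e , tt))

    dist-step : ∀ {u w} → u ≢ w → ∃ λ v → dist u v ≡ 1 × dist u w ≡ suc (dist v w)
    dist-step {u} {w} u≢w with geo u w | geo-reduced u w
    ... | []    | _       = ⊥-elim (u≢w refl)
    ... | e ∷ p | (_ , r) = _ , dist-adj e , cong suc (reduced-dist p r)

    -- The geodesic from `v` to `s` either starts through `u`, and its tail is the one from `u`, or
    -- it does not, and putting `e` in front keeps it reduced.
    edge-cases : ∀ {u v} → Adj G u v → ∀ s →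
      (Reduced u (geo v s) × dist u s ≡ suc (dist v s)) ⊎ dist v s ≡ suc (dist u s)
    edge-cases {u} {v} e s with geo v s in eq | geo-reduced v s
    ... | [] | _ = inj₁ (tt , ≡-sym (reduced-dist {f = u} (e ∷ []) (adj⇒≢ e , tt)))
    ... | _∷_ {v = x} e′ p | (_ , r) with x Fin.≟ u
    ...   | yes refl = inj₂ (cong suc (reduced-dist p r))
    ...   | no x≢u = inj₁ ((x≢u , r) , ≡-sym (reduced-dist {f = u} (e ∷ e′ ∷ p) (adj⇒≢ e , x≢u , r)))

    far-side-reduced : ∀ {u v s} → Adj G u v → dist u s ≡ suc (dist v s) → Reduced u (geo v s)
    far-side-reduced {s = s} e eq with edge-cases e s
    ... | inj₁ (r , _) = r
    ... | inj₂ eq′     = ⊥-elim (≡suc-asym eq eq′)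

    -- The walk from `s` to `u`, across the edge and on to `t` is reduced, since neither geodesic
    -- used starts along that edge.
    dist-cross : ∀ {u v s t} → dist u v ≡ 1 → dist v s ≡ suc (dist u s) → dist u t ≡ suc (dist v t) →
                 dist s t ≡ dist u s + suc (dist v t)
    dist-cross {u} {v} {s} {t} d1 su tv =
      trans (≡-sym (reduced-dist w (revApp-reduced (geo u s) (adj d1) (geo v t)
                    (far-side-reduced (Graph.sym G (adj d1)) su) (far-side-reduced (adj d1) tv))))
            (len-revApp (geo u s) _)
      where w = revApp (geo u s) (adj d1 ∷ geo v t)

    dist-edge : ∀ {u v} → dist u v ≡ 1 → ∀ s → dist v s ≡ suc (dist u s) ⊎ dist u s ≡ suc (dist v s)
    dist-edge d1 s with edge-cases (adj d1) s
    ... | inj₁ (_ , eq) = inj₂ eq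
    ... | inj₂ eq       = inj₁ eq

    metric : TreeMetric n
    metric = record
      { δ = dist ; δ-refl = λ u → ≡-sym (reduced-dist {f = u} ([] {u = u}) tt) ; δ-zero = walk₀ (geo _ _)
      ; δ-sym = dist-sym ; δ-tri = dist-tri ; δ-step = dist-step ; δ-edge = dist-edge ; δ-cross = dist-cross }

  -- Subsets from decidable predicates, and counting.

  comprehension : ∀ {n} {P : Fin n → Set} → Decidable P → Subset n
  comprehension P? = tabulate (λ i → does (P? i))

  module _ {n : ℕ} {P : Fin n → Set} (P? : Decidable P) where

    ∈-comprehension⁺ : ∀ {x} → P x → x ∈ comprehension P?
    ∈-comprehension⁺ {x} px = lookup⇒[]= x _ (trans (lookup∘tabulate _ x) (dec-true (P? x) px))

    ∈-comprehension⁻ : ∀ {x} → x ∈ comprehension P? → P x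
    ∈-comprehension⁻ {x} x∈ with P? x | trans (≡-sym (lookup∘tabulate (λ i → does (P? i)) x)) ([]=⇒lookup x∈)
    ... | yes px | _  = px
    ... | no  _  | ()

  ∣p∩q∣+∣p─q∣≡∣p∣ : ∀ {n} (p q : Subset n) → ∣ p ∩ q ∣ + ∣ p ─ q ∣ ≡ ∣ p ∣
  ∣p∩q∣+∣p─q∣≡∣p∣ []            []            = refl
  ∣p∩q∣+∣p─q∣≡∣p∣ (outside ∷ p) (outside ∷ q) = ∣p∩q∣+∣p─q∣≡∣p∣ p q
  ∣p∩q∣+∣p─q∣≡∣p∣ (outside ∷ p) (inside  ∷ q) = ∣p∩q∣+∣p─q∣≡∣p∣ p q
  ∣p∩q∣+∣p─q∣≡∣p∣ (inside  ∷ p) (outside ∷ q) = trans (+-suc _ _) (cong suc (∣p∩q∣+∣p─q∣≡∣p∣ p q))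
  ∣p∩q∣+∣p─q∣≡∣p∣ (inside  ∷ p) (inside  ∷ q) = cong suc (∣p∩q∣+∣p─q∣≡∣p∣ p q)

  -- Sides of an edge, convex sets and branches.

  module Tree {n : ℕ} (M : TreeMetric n) where
    open TreeMetric M public

    -- For an edge `u v`, the component of `u` after the edge is removed.
    Side : Fin n → Fin n → Fin n → Set
    Side u v s = δ v s ≡ suc (δ u s)

    Side? : ∀ u v → Decidable (Side u v)
    Side? u v s = δ v s ≟ suc (δ u s)

    Side-asym : ∀ {u v s} → Side u v s → ¬ Side v u s
    Side-asym p q = ≡suc-asym p q

    -- In a tree this is connectedness, in the form that δ-cross can use.
    Convex : Subset n → Set
    Convex S = ∀ {y z} → y ∈ S → z ∉ S → δ y z ≡ 1 → ∀ {s} → s ∈ S → Side y z s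

    -- If the first step towards `w` left `S`, convexity would put `w` on the near side of that
    -- step.
    convex-step : ∀ {S u v w} → Convex S → u ∈ S → w ∈ S → δ u v ≡ 1 → Side v u w → v ∈ S
    convex-step {S} {u} {v} cv u∈ w∈ uv side with v ∈? S
    ... | yes v∈ = v∈
    ... | no  v∉ = ⊥-elim (Side-asym {v} {u} side (cv u∈ v∉ uv w∈))

    full-convex : Convex Subset.⊤
    full-convex _ z∉ = ⊥-elim (z∉ ∈⊤)

    -- The geodesic from s to c stays in S and meets every level of δ · c up to δ s c.
    convex-diam : ∀ {S s c} → Convex S → s ∈ S → c ∈ S → δ s c < ∣ S ∣
    convex-diam {S} {s₀} {c} cv s₀∈ c∈ = ≤-trans (levels (δ s₀ c) s₀ s₀∈ refl) (p⊆q⇒∣p∣≤∣q∣ (proj₁ ∘ x∈p∩q⁻ S _))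
      where
      near? : ∀ k → Decidable (λ t → δ t c ≤ k)
      near? k t = δ t c ≤? k

      ball : ℕ → Subset n
      ball k = S ∩ comprehension (near? k)

      ∈ball⁺ : ∀ {k t} → t ∈ S → δ t c ≤ k → t ∈ ball k
      ∈ball⁺ t∈ le = x∈p∩q⁺ (t∈ , ∈-comprehension⁺ (near? _) le)

      ∈ball⁻ : ∀ {k t} → t ∈ ball k → t ∈ S × δ t c ≤ k
      ∈ball⁻ {k} t∈ = let (a , b) = x∈p∩q⁻ S _ t∈ in a , ∈-comprehension⁻ (near? k) b

      levels : ∀ k s → s ∈ S → δ s c ≡ k → k < ∣ ball k ∣
      levels zero    s s∈ eq = ≤-trans (≤-reflexive (≡-sym (∣⁅x⁆∣≡1 s)))
        (p⊆q⇒∣p∣≤∣q∣ λ x∈ → subst (_∈ ball 0) (≡-sym (x∈⁅y⁆⇒x≡y s x∈)) (∈ball⁺ s∈ (≤-reflexive eq)))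
      levels (suc k) s s∈ eq with δ-step {s} {c} (λ { refl → 0≢1+n (trans (≡-sym (δ-refl s)) eq) })
      ... | v , sv , sc = ≤-trans (s≤s (levels k v v∈ (suc-injective (trans (≡-sym sc) eq))))
        (p⊂q⇒∣p∣<∣q∣ ((λ t∈ → let (a , b) = ∈ball⁻ t∈ in ∈ball⁺ a (m≤n⇒m≤1+n b))
                    , s , ∈ball⁺ s∈ (≤-reflexive eq) , λ s∈′ → 1+n≰n (≤-trans (≤-reflexive (≡-sym eq)) (proj₂ (∈ball⁻ s∈′)))))
        where v∈ = convex-step cv s∈ c∈ sv sc

    -- For an edge `p v`, the part of `S` beyond `v`. Thus `branch S v u` and `branch S u v` are the
    -- two halves left by cutting the edge `u v`.
    branch : Subset n → Fin n → Fin n → Subset n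
    branch S p v = S ∩ comprehension (Side? v p)

    ∈branch⁺ : ∀ {S p v s} → s ∈ S → Side v p s → s ∈ branch S p v
    ∈branch⁺ {p = p} {v} s∈ side = x∈p∩q⁺ (s∈ , ∈-comprehension⁺ (Side? v p) side)

    ∈branch⁻ : ∀ {S p v s} → s ∈ branch S p v → s ∈ S × Side v p s
    ∈branch⁻ {S} {p} {v} s∈ = let (a , b) = x∈p∩q⁻ S _ s∈ in a , ∈-comprehension⁻ (Side? v p) b

    δ-sym₁ : ∀ {u v} → δ u v ≡ 1 → δ v u ≡ 1
    δ-sym₁ {u} {v} eq = trans (δ-sym v u) eq

    side-self : ∀ {u v} → δ u v ≡ 1 → Side v u v
    side-self {u} {v} uv = trans uv (cong suc (≡-sym (δ-refl v)))

    crossing-edge : ∀ {u v y z} → δ u v ≡ 1 → Side u v y → Side v u z → δ y z ≡ 1 → y ≡ u × z ≡ v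
    crossing-edge {u} {v} {y} {z} uv yu zv yz =
        ≡-sym (δ-zero (m+n≡0⇒m≡0 (δ u y) sum≡0)) , ≡-sym (δ-zero (m+n≡0⇒n≡0 (δ u y) sum≡0))
      where
      sum≡0 : δ u y + δ v z ≡ 0
      sum≡0 = suc-injective (trans (≡-sym (+-suc (δ u y) (δ v z))) (trans (≡-sym (δ-cross uv yu zv)) yz))

    -- An edge leaving the branch either leaves `S` or, by `crossing-edge`, is the edge from `v` to
    -- `p`.
    branch-convex : ∀ {S p v} → Convex S → δ p v ≡ 1 → Convex (branch S p v)
    branch-convex {S} {p} {v} cv pv {y} {z} y∈ z∉ yz {s} s∈ with z ∈? S | δ-edge pv z
    ... | no  z∉S | _ = cv (proj₁ (∈branch⁻ {S} {p} {v} y∈)) z∉S yz (proj₁ (∈branch⁻ {S} {p} {v} s∈))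
    ... | yes z∈S | inj₂ zv = ⊥-elim (z∉ (∈branch⁺ z∈S zv))
    ... | yes z∈S | inj₁ zp with crossing-edge (δ-sym₁ pv) (proj₂ (∈branch⁻ {S} y∈)) zp yz
    ...   | refl , refl = proj₂ (∈branch⁻ {S} s∈)

    branch-sizes : ∀ {S u v} → ∣ branch S v u ∣ + ∣ branch S u v ∣ ≤ ∣ S ∣
    branch-sizes {S} {u} {v} = ≤-trans (+-monoʳ-≤ ∣ branch S v u ∣ (p⊆q⇒∣p∣≤∣q∣ sub))
        (≤-reflexive (∣p∩q∣+∣p─q∣≡∣p∣ S (comprehension (Side? u v))))
      where
      sub : branch S u v ⊆ S ─ comprehension (Side? u v)
      sub x∈ = let (a , b) = ∈branch⁻ {S} x∈ in
        x∈p∧x∉q⇒x∈p─q a (λ x∈′ → Side-asym {v} {u} b (∈-comprehension⁻ (Side? u v) x∈′))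

    other-side : ∀ {p v w} → δ p v ≡ 1 → δ p w ≡ 1 → v ≢ w → Side p v w
    other-side {p} {v} {w} pv pw v≢w with δ-edge pv w
    ... | inj₁ s = s
    ... | inj₂ s = ⊥-elim (v≢w (δ-zero (suc-injective (trans (≡-sym s) pw))))

    -- This is what makes different branches at `p` disjoint: the geodesic from `v` to `t` crosses
    -- the edge `p w`.
    opposite : ∀ {p v w t} → δ p v ≡ 1 → δ p w ≡ 1 → v ≢ w → Side w p t → Side p v t
    opposite {p} {v} {w} {t} pv pw v≢w tw =
      trans (δ-cross pw (other-side pw pv (≢-sym v≢w)) tw) (trans (cong (_+ suc (δ w t)) pv) (cong suc (≡-sym tw)))

    branch-dist : ∀ {p v w s t} → δ p v ≡ 1 → δ p w ≡ 1 → v ≢ w → Side v p s → Side w p t → δ s t ≡ δ p s + δ p t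
    branch-dist {p} {v} {w} {s} {t} pv pw v≢w sv tw =
      trans (δ-cross (δ-sym₁ pv) sv (opposite pv pw v≢w tw)) (trans (+-suc (δ v s) (δ p t)) (cong (_+ δ p t) (≡-sym sv)))

    -- Packings and their extension over a set.

    Packing : List (Fin n) → Set
    Packing L = ∀ {x y} → x ∈ˡ L → y ∈ˡ L → x ≢ y → 3 ≤ δ x y

    packing-++ : ∀ {A B} → Packing A → Packing B → (∀ {x y} → x ∈ˡ A → y ∈ˡ B → 3 ≤ δ x y) → Packing (A ++ B)
    packing-++ {A} pa pb pab x∈ y∈ x≢y with ∈-++⁻ A x∈ | ∈-++⁻ A y∈
    ... | inj₁ a | inj₁ b = pa a b x≢y
    ... | inj₁ a | inj₂ b = pab a b
    ... | inj₂ a | inj₁ b = subst (3 ≤_) (δ-sym _ _) (pab b a)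
    ... | inj₂ a | inj₂ b = pb a b x≢y

    Dominates : ℕ → List (Fin n) → Subset n → Set
    Dominates d L S = ∀ {s} → s ∈ S → ∃ λ x → x ∈ˡ L × δ s x ≤ d

    -- `from` confines the new vertices to `S`; after one half is treated, the enlarged packing
    -- therefore still lies on one side of the edge to the other half.
    record Extension (d : ℕ) (S : Subset n) (J : ℕ) (X : List (Fin n)) : Set where
      constructor extension
      field
        list    : List (Fin n)
        packing : Packing list
        dom     : Dominates d list S
        keeps   : ∀ {x} → x ∈ˡ X → x ∈ˡ list
        from    : ∀ {x} → x ∈ˡ list → x ∈ˡ X ⊎ x ∈ S
        size    : length list ≤ J + length X

    -- Every leaving edge is allowed, since gluing may enter the set through any of them.
    Extendable : ℕ → Subset n → ℕ → Set
    Extendable d S J = ∀ {y z} → y ∈ S → z ∉ S → δ y z ≡ 1 →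
      ∀ X → Packing X → (∀ {x} → x ∈ˡ X → Side z y x) → Extension d S J X

    -- For a union of K clusters: J is the sum and q the maximum of the numbers j of the clusters.
    record Good (d : ℕ) (S : Subset n) : Set where
      constructor good
      field
        K J q  : ℕ
        1≤K    : 1 ≤ K
        sized  : d * J + K ≤ ∣ S ∣
        J≤qK   : J ≤ q * K
        extend : Extendable d S J
        own    : ∃ λ L → Packing L × Dominates d L S × (∀ {x} → x ∈ˡ L → x ∈ S) × length L + q ≤ suc J

    -- Gluing two halves along an edge.

    module Glue {d : ℕ} {S : Subset n} {u v : Fin n} (cv : Convex S) (u∈ : u ∈ S) (v∈ : v ∈ S) (uv : δ u v ≡ 1) where
      A = branch S v u
      B = branch S u v

      v∈B : v ∈ B
      v∈B = ∈branch⁺ v∈ (side-self uv)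

      u∉B : u ∉ B
      u∉B m = Side-asym {v} {u} (proj₂ (∈branch⁻ {S} m)) (side-self (δ-sym₁ uv))

      cover : ∀ {s} → s ∈ S → s ∈ A ⊎ s ∈ B
      cover {s} s∈ with δ-edge uv s
      ... | inj₁ x = inj₁ (∈branch⁺ s∈ x)
      ... | inj₂ x = inj₂ (∈branch⁺ s∈ x)

      dom-∪ : ∀ {L L′} → Dominates d L A → Dominates d L′ B → (∀ {x} → x ∈ˡ L → x ∈ˡ L′) → Dominates d L′ S
      dom-∪ da db sub s∈ with cover s∈
      ... | inj₁ a = let (x , x∈ , le) = da a in x , sub x∈ , le
      ... | inj₂ b = db b

      -- The half that contains `y` is treated first; the result lies on the side of `u`, so it
      -- extends over `B` through the edge `v u`.
      extendA-B : ∀ {J J′ y z} → Extendable d A J → Extendable d B J′ → y ∈ A → z ∉ S → δ y z ≡ 1 →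
        ∀ X → Packing X → (∀ {x} → x ∈ˡ X → Side z y x) → Extension d S (J + J′) X
      extendA-B {J} {J′} {y} {z} ea eb y∈ z∉ yz X pX sX =
        extension E₂.list E₂.packing (dom-∪ E₁.dom E₂.dom E₂.keeps) (E₂.keeps ∘ E₁.keeps) from′
          (≤-trans E₂.size (≤-trans (+-monoʳ-≤ J′ E₁.size)
            (≤-reflexive (trans (≡-sym (+-assoc J′ J _)) (cong (_+ length X) (+-comm J′ J))))))
        where
        y∈S = proj₁ (∈branch⁻ {S} y∈)
        module E₁ = Extension (ea y∈ (z∉ ∘ proj₁ ∘ ∈branch⁻ {S}) yz X pX sX)
        toward : ∀ {x} → x ∈ˡ E₁.list → Side u v x
        toward {x} x∈ with E₁.from x∈
        ... | inj₂ a = proj₂ (∈branch⁻ {S} a)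
        -- Geodesics from `u` and from `v` to `x` both leave `S` along `y z`, and `y` is nearer to
        -- `u`.
        ... | inj₁ b = trans (δ-cross yz (cv y∈S z∉ yz v∈) (sX b))
                (trans (cong (_+ suc (δ z x)) (trans (δ-sym y v) (trans (proj₂ (∈branch⁻ {S} y∈)) (cong suc (δ-sym u y)))))
                  (cong suc (≡-sym (δ-cross yz (cv y∈S z∉ yz u∈) (sX b)))))
        module E₂ = Extension (eb v∈B u∉B (δ-sym₁ uv) E₁.list E₁.packing toward)
        from′ : ∀ {x} → x ∈ˡ E₂.list → x ∈ˡ X ⊎ x ∈ S
        from′ x∈ with E₂.from x∈
        ... | inj₂ b = inj₂ (proj₁ (∈branch⁻ {S} b))
        ... | inj₁ m with E₁.from m
        ...   | inj₁ a = inj₁ a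
        ...   | inj₂ a = inj₂ (proj₁ (∈branch⁻ {S} a))

      -- The set for `A` keeps its saving, and `B` is then added at its full cost.
      ownA-B : (ga : Good d A) (gb : Good d B) → let open Good in
        ∃ λ L → Packing L × Dominates d L S × (∀ {x} → x ∈ˡ L → x ∈ S) × length L + q ga ≤ suc (J ga + J gb)
      ownA-B ga gb with Good.own ga
      ... | L , pL , dL , L⊆ , le = E.list , E.packing , dom-∪ dL E.dom E.keeps , from′ ,
          ≤-trans (+-monoˡ-≤ GA.q E.size) (≤-trans (≤-reflexive (+-assoc GB.J (length L) GA.q))
            (≤-trans (+-monoʳ-≤ GB.J le) (≤-reflexive (+-comm GB.J (suc GA.J)))))
        where
        module GA = Good ga
        module GB = Good gb
        module E = Extension (GB.extend v∈B u∉B (δ-sym₁ uv) L pL (λ x∈ → proj₂ (∈branch⁻ {S} (L⊆ x∈))))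
        from′ : ∀ {x} → x ∈ˡ E.list → x ∈ S
        from′ x∈ with E.from x∈
        ... | inj₁ m = proj₁ (∈branch⁻ {S} (L⊆ m))
        ... | inj₂ b = proj₁ (∈branch⁻ {S} b)

    glue : ∀ {d S u v} → Convex S → u ∈ S → v ∈ S → δ u v ≡ 1 → Good d (branch S v u) → Good d (branch S u v) → Good d S
    glue {d} {S} {u} {v} cv u∈ v∈ uv ga gb = good (A.K + B.K) (A.J + B.J) (A.q ⊔ B.q)
        (≤-trans A.1≤K (m≤m+n A.K B.K))
        (≤-trans (≤-reflexive sized′) (≤-trans (+-mono-≤ A.sized B.sized) (branch-sizes {S} {u} {v})))
        (≤-trans (+-mono-≤ (≤-trans A.J≤qK (*-monoˡ-≤ A.K (m≤m⊔n A.q B.q)))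
                           (≤-trans B.J≤qK (*-monoˡ-≤ B.K (m≤n⊔m A.q B.q))))
          (≤-reflexive (≡-sym (*-distribˡ-+ (A.q ⊔ B.q) A.K B.K))))
        extend′ own′
      where
      module A = Good ga
      module B = Good gb
      module AB = Glue {d} cv u∈ v∈ uv
      module BA = Glue {d} cv v∈ u∈ (δ-sym₁ uv)
      sized′ : d * (A.J + B.J) + (A.K + B.K) ≡ d * A.J + A.K + (d * B.J + B.K)
      sized′ = solve 5 (λ d J J′ K K′ → d :* (J :+ J′) :+ (K :+ K′) := d :* J :+ K :+ (d :* J′ :+ K′)) refl d A.J B.J A.K B.K
      extend′ : Extendable d S (A.J + B.J)
      extend′ y∈ z∉ yz X pX sX with AB.cover y∈
      ... | inj₁ a = AB.extendA-B A.extend B.extend a z∉ yz X pX sX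
      ... | inj₂ b = subst (λ J → Extension d S J X) (+-comm B.J A.J) (BA.extendA-B B.extend A.extend b z∉ yz X pX sX)
      own′ : ∃ λ L → Packing L × Dominates d L S × (∀ {x} → x ∈ˡ L → x ∈ S) × length L + (A.q ⊔ B.q) ≤ suc (A.J + B.J)
      -- Only the saving of the starting half survives, so the half with the larger `q` goes first.
      own′ with ≤-total B.q A.q
      ... | inj₁ le rewrite m≥n⇒m⊔n≡m le = AB.ownA-B ga gb
      ... | inj₂ le rewrite m≤n⇒m⊔n≡n le | +-comm A.J B.J = BA.ownA-B gb ga

  -- Clusters: convex sets with a centre.

  module Cluster {n : ℕ} (M : TreeMetric n) {d : ℕ} (2≤d : 2 ≤ d) where
    open Tree M

    module _ {S : Subset n} (cv : Convex S) (p : Fin n) (p∈ : p ∈ S) (d<∣S∣ : d < ∣ S ∣)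
             (small : ∀ v → δ p v ≡ 1 → v ∈ S → ∣ branch S p v ∣ ≤ d) where

      B : Fin n → Subset n
      B = branch S p

      Root : Fin n → Set
      Root v = δ p v ≡ 1 × v ∈ S

      root? : Decidable Root
      root? v = (δ p v ≟ 1) ×-dec (v ∈? S)

      Big : Fin n → Set
      Big v = Root v × ∣ B v ∣ ≡ d

      big? : Decidable Big
      big? v = root? v ×-dec (∣ B v ∣ ≟ d)

      bigs : List (Fin n)
      bigs = filter big? (allFin n)

      ∈bigs⁺ : ∀ {v} → Big v → v ∈ˡ bigs
      ∈bigs⁺ {v} = ∈-filter⁺ big? (∈-allFin v)

      ∈bigs⁻ : ∀ {v} → v ∈ˡ bigs → Big v
      ∈bigs⁻ v∈ = proj₂ (∈-filter⁻ big? {xs = allFin n} v∈)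

      -- The branches are disjoint by `opposite`, so each one takes `d` new vertices out of `R`.
      big-branches-fit : ∀ vs (R : Subset n) → Unique vs → (∀ {v} → v ∈ˡ vs → Big v × B v ⊆ R) → d * length vs ≤ ∣ R ∣
      big-branches-fit []       R _       _ = ≤-trans (≤-reflexive (*-zeroʳ d)) z≤n
      big-branches-fit (v ∷ vs) R (a ∷ u) h = ≤-trans (≤-reflexive (*-suc d (length vs)))
        (≤-trans (+-mono-≤ (≤-trans (≤-reflexive (≡-sym ∣Bv∣)) (p⊆q⇒∣p∣≤∣q∣ λ x∈ → x∈p∩q⁺ (Bv⊆R x∈ , x∈)))
                           (big-branches-fit vs (R ─ B v) u h′))
                 (≤-reflexive (∣p∩q∣+∣p─q∣≡∣p∣ R (B v))))
        where
        pv    = proj₁ (proj₁ (proj₁ (h (here refl))))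
        ∣Bv∣  = proj₂ (proj₁ (h (here refl)))
        Bv⊆R  = proj₂ (h (here refl))
        h′ : ∀ {w} → w ∈ˡ vs → Big w × B w ⊆ R ─ B v
        h′ {w} w∈ with h (there w∈)
        ... | bw@((pw , _) , _) , sub = bw , λ x∈ → x∈p∧x∉q⇒x∈p─q (sub x∈) λ x∈′ →
          Side-asym {v} {p} (proj₂ (∈branch⁻ {S} x∈′)) (opposite pv pw (All.lookup a w∈) (proj₂ (∈branch⁻ {S} x∈)))

      -- Strict because `p` itself lies in no branch.
      bigs-fit : d * length bigs < ∣ S ∣
      bigs-fit = ≤-trans (s≤s (big-branches-fit bigs (S - p) (Unique.filter⁺ big? (Unique.allFin⁺ n)) h)) (x∈p⇒∣p-x∣<∣p∣ p∈)
        where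
        h : ∀ {v} → v ∈ˡ bigs → Big v × B v ⊆ S - p
        h {v} v∈ = ∈bigs⁻ v∈ , λ x∈ → let (x∈S , side) = ∈branch⁻ {S} x∈ in
          x∈p∧x≢y⇒x∈p-y x∈S λ { refl → 0≢1+n (trans (≡-sym (δ-refl p)) side) }

      -- At least 1, so that a single new vertex is always within the budget.
      J = 1 ⊔ length bigs

      J-sized : d * J + 1 ≤ ∣ S ∣
      J-sized with ≤-total 1 (length bigs)
      ... | inj₁ le rewrite m≤n⇒m⊔n≡n le = ≤-trans (≤-reflexive (+-comm _ 1)) bigs-fit
      -- Here `J` is 1, and the count is the assumption that `S` has more than `d` vertices.
      ... | inj₂ le rewrite m≥n⇒m⊔n≡m le | *-identityʳ d = ≤-trans (≤-reflexive (+-comm d 1)) d<∣S∣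

      cover : ∀ {s} → s ∈ S → s ≡ p ⊎ ∃ λ v → Root v × s ∈ B v
      cover {s} s∈ with p Fin.≟ s
      ... | yes eq = inj₁ (≡-sym eq)
      ... | no p≢s with δ-step p≢s
      ...   | v , pv , side = inj₂ (v , (pv , convex-step cv p∈ s∈ pv side) , ∈branch⁺ s∈ side)

      branch-diam : ∀ {v s t} → Root v → s ∈ B v → t ∈ B v → δ s t < ∣ B v ∣
      branch-diam (pv , v∈) = convex-diam (branch-convex cv pv)

      root∈B : ∀ {v} → Root v → v ∈ B v
      root∈B (pv , v∈) = ∈branch⁺ v∈ (side-self pv)

      depth : ∀ {v s} → Root v → s ∈ B v → δ p s ≤ ∣ B v ∣
      depth r s∈ = ≤-trans (≤-reflexive (proj₂ (∈branch⁻ {S} s∈))) (branch-diam r (root∈B r) s∈)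

      depth≤d : ∀ {s} → s ∈ S → δ p s ≤ d
      depth≤d s∈ with cover s∈
      ... | inj₁ refl = ≤-trans (≤-reflexive (δ-refl p)) z≤n
      ... | inj₂ (v , r@(pv , v∈) , s∈B) = ≤-trans (depth r s∈B) (small v pv v∈)

      -- The spare step lets any vertex within distance 1 of `p` dominate such a branch.
      depth<d : ∀ {v s} → Root v → ¬ Big v → s ∈ B v → δ p s < d
      depth<d {v} r@(pv , v∈) ¬big s∈ = ≤-<-trans (depth r s∈) (≤∧≢⇒< (small v pv v∈) (λ eq → ¬big (r , eq)))

      branch≤d : ∀ {v s t} → Root v → s ∈ B v → t ∈ B v → δ s t ≤ d
      branch≤d {v} r@(pv , v∈) s∈ t∈ = ≤-trans (<⇒≤ (branch-diam r s∈ t∈)) (small v pv v∈)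

      -- Since `d` is at least 2, a branch of size `d` has a vertex other than `v`. The default `v`
      -- makes `deep` total, so that it can be mapped over lists.
      deeper : ∀ v → ∃ λ c → Big v → c ∈ B v × 2 ≤ δ p c
      deeper v with Fin.any? (λ c → (c ∈? B v) ×-dec ¬? (c Fin.≟ v))
      ... | yes (c , c∈ , c≢v) = c , λ _ → c∈ ,
        ≤-trans (s≤s (n≢0⇒n>0 (λ eq → c≢v (≡-sym (δ-zero eq))))) (≤-reflexive (≡-sym (proj₂ (∈branch⁻ {S} c∈))))
      ... | no none = v , λ (r , eq) → ⊥-elim (1+n≰n (≤-trans 2≤d (≤-trans (≤-reflexive (≡-sym eq))
          (≤-trans (p⊆q⇒∣p∣≤∣q∣ only) (≤-reflexive (∣⁅x⁆∣≡1 v))))))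
        where
        only : B v ⊆ ⁅ v ⁆
        only {x} x∈ with x Fin.≟ v
        ... | yes refl = x∈⁅x⁆ v
        ... | no  x≢v  = ⊥-elim (none (x , x∈ , x≢v))

      deep : Fin n → Fin n
      deep v = proj₁ (deeper v)

      deep∈ : ∀ {v} → Big v → deep v ∈ B v
      deep∈ b = proj₁ (proj₂ (deeper _) b)

      2≤deep : ∀ {v} → Big v → 2 ≤ δ p (deep v)
      2≤deep b = proj₂ (proj₂ (deeper _) b)

      module _ {r : Fin n} (pr : δ p r ≡ 1) (X : List (Fin n)) (pX : Packing X) (toward : ∀ {x} → x ∈ˡ X → Side r p x) where

        -- By `branch-dist`, distances between different branches add up at `p`, so only distances
        -- to `p` matter. The neighbour `r` is excluded because `X` lies beyond it.
        packing-branches : (f : Fin n → Fin n) (vs : List (Fin n)) →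
          (∀ {v} → v ∈ˡ vs → Root v × v ≢ r × f v ∈ B v) →
          (∀ {v w} → v ∈ˡ vs → w ∈ˡ vs → v ≢ w → 3 ≤ δ p (f v) + δ p (f w)) →
          (∀ {v x} → v ∈ˡ vs → x ∈ˡ X → 3 ≤ δ p (f v) + δ p x) → Packing (map f vs ++ X)
        packing-branches f vs h far farX = packing-++ inner pX outer
          where
          inner : Packing (map f vs)
          inner x∈ y∈ x≢y with ∈-map⁻ f x∈ | ∈-map⁻ f y∈
          ... | v , v∈ , refl | w , w∈ , refl with h v∈ | h w∈
          ...   | (pv , _) , _ , sv | (pw , _) , _ , sw =
            subst (3 ≤_) (≡-sym (branch-dist pv pw v≢w (proj₂ (∈branch⁻ {S} sv)) (proj₂ (∈branch⁻ {S} sw)))) (far v∈ w∈ v≢w)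
            where v≢w = x≢y ∘ cong f
          outer : ∀ {x y} → x ∈ˡ map f vs → y ∈ˡ X → 3 ≤ δ x y
          outer x∈ y∈ with ∈-map⁻ f x∈
          ... | v , v∈ , refl with h v∈
          ...   | (pv , _) , v≢r , sv = subst (3 ≤_) (≡-sym (branch-dist pv pr v≢r (proj₂ (∈branch⁻ {S} sv)) (toward y∈))) (farX v∈ y∈)

        extension-branches : (f : Fin n → Fin n) (vs : List (Fin n)) →
          (∀ {v} → v ∈ˡ vs → Root v × v ≢ r × f v ∈ B v) →
          (∀ {v w} → v ∈ˡ vs → w ∈ˡ vs → v ≢ w → 3 ≤ δ p (f v) + δ p (f w)) →
          (∀ {v x} → v ∈ˡ vs → x ∈ˡ X → 3 ≤ δ p (f v) + δ p x) →
          Dominates d (map f vs ++ X) S → length vs ≤ J → Extension d S J X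
        extension-branches f vs h far farX dm le =
          extension (map f vs ++ X) (packing-branches f vs h far farX) dm (∈-++⁺ʳ (map f vs)) from′
            (≤-trans (≤-reflexive (trans (length-++ (map f vs)) (cong (_+ length X) (length-map f vs)))) (+-monoˡ-≤ (length X) le))
          where
          from′ : ∀ {x} → x ∈ˡ map f vs ++ X → x ∈ˡ X ⊎ x ∈ S
          from′ x∈ with ∈-++⁻ (map f vs) x∈
          ... | inj₂ m = inj₁ m
          ... | inj₁ m with ∈-map⁻ f m
          ...   | v , v∈ , refl = inj₂ (proj₁ (∈branch⁻ {S} (proj₂ (proj₂ (h v∈)))))

        side-positive : ∀ {x} → x ∈ˡ X → 1 ≤ δ p x
        side-positive x∈ = ≤-trans (s≤s z≤n) (≤-reflexive (≡-sym (toward x∈)))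

        -- Here `x` is adjacent to `p` and dominates `p` and all branches with fewer than `d`
        -- vertices. Each remaining branch gets a vertex at distance at least 2 from `p`, hence at
        -- least 3 from `X` and from the others.
        extend-dist₁ : r ∉ S → ∀ {x} → x ∈ˡ X → δ p x ≤ 1 → Extension d S J X
        extend-dist₁ r∉ {x} x∈ le = extension-branches deep bigs
            (λ v∈ → let b = ∈bigs⁻ v∈ in proj₁ b , (λ { refl → r∉ (proj₂ (proj₁ b)) }) , deep∈ b)
            (λ v∈ w∈ _ → ≤-trans (n≤1+n 3) (+-mono-≤ (2≤deep (∈bigs⁻ v∈)) (2≤deep (∈bigs⁻ w∈))))
            (λ v∈ y∈ → +-mono-≤ (2≤deep (∈bigs⁻ v∈)) (side-positive y∈)) dm (m≤n⊔m 1 (length bigs))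
          where
          dm : Dominates d (map deep bigs ++ X) S
          dm {s} s∈ with cover s∈
          ... | inj₁ refl = x , ∈-++⁺ʳ (map deep bigs) x∈ , ≤-trans le (<⇒≤ 2≤d)
          ... | inj₂ (v , rt , s∈B) with big? v
          ...   | yes b = deep v , ∈-++⁺ˡ (∈-map⁺ deep (∈bigs⁺ b)) , branch≤d rt s∈B (deep∈ b)
          ...   | no ¬b = x , ∈-++⁺ʳ (map deep bigs) x∈ , ≤-trans (δ-tri s p x)
                    (≤-trans (+-mono-≤ (≤-reflexive (δ-sym s p)) le) (≤-trans (≤-reflexive (+-comm (δ p s) 1)) (depth<d rt ¬b s∈B)))

        module _ (no₁ : ∀ {x} → x ∈ˡ X → 2 ≤ δ p x) {x : Fin n} (x∈ : x ∈ˡ X) (le : δ p x ≤ 2) where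

          -- `x` is within 1 of `r`, so a vertex beyond `r` is no farther from `x` than from `p`.
          own-branch : ∀ {s} → s ∈ B r → δ s x ≤ d
          own-branch {s} s∈ = ≤-trans (δ-tri s r x) (≤-trans (+-mono-≤ (≤-reflexive (δ-sym s r)) rx≤1)
              (≤-trans (≤-reflexive (trans (+-comm (δ r s) 1) (≡-sym (proj₂ (∈branch⁻ {S} s∈))))) (depth≤d (proj₁ (∈branch⁻ {S} s∈)))))
            where
            rx≤1 : δ r x ≤ 1
            rx≤1 = s≤s⁻¹ (≤-trans (≤-reflexive (≡-sym (toward x∈))) le)

          p-dominated : δ p x ≤ d
          p-dominated = ≤-trans le 2≤d

          -- b covers its own branch and every vertex at distance less than d from p.
          extend-via : (b : Fin n) (vs : List (Fin n)) → b ∈ˡ vs → length vs ≤ J →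
            (∀ {v} → v ∈ˡ vs → Root v × v ≢ r × (v ≢ b → Big v)) →
            (∀ {v} → Big v → v ≢ r → v ∈ˡ vs) → Extension d S J X
          extend-via b vs b∈ len h complete = extension-branches f vs
              (λ v∈ → proj₁ (h v∈) , proj₁ (proj₂ (h v∈)) , f∈ v∈) far
              (λ v∈ y∈ → +-mono-≤ (f-pos v∈) (no₁ y∈)) dm len
            where
            f : Fin n → Fin n
            f v with v Fin.≟ b
            ... | yes _ = b
            ... | no  _ = deep v
            f-b : f b ≡ b
            f-b with b Fin.≟ b
            ... | yes _   = refl
            ... | no  b≢b = ⊥-elim (b≢b refl)
            f∈ : ∀ {v} → v ∈ˡ vs → f v ∈ B v
            f∈ {v} v∈ with v Fin.≟ b
            ... | yes refl = root∈B (proj₁ (h v∈))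
            ... | no  v≢b  = deep∈ (proj₂ (proj₂ (h v∈)) v≢b)
            f-pos : ∀ {v} → v ∈ˡ vs → 1 ≤ δ p (f v)
            f-pos v∈ = ≤-trans (s≤s z≤n) (≤-reflexive (≡-sym (proj₂ (∈branch⁻ {S} (f∈ v∈)))))
            f-deep : ∀ {v} → v ∈ˡ vs → v ≢ b → 2 ≤ δ p (f v)
            f-deep {v} v∈ v≢b with v Fin.≟ b
            ... | yes eq = ⊥-elim (v≢b eq)
            ... | no  _  = 2≤deep (proj₂ (proj₂ (h v∈)) v≢b)
            far : ∀ {v w} → v ∈ˡ vs → w ∈ˡ vs → v ≢ w → 3 ≤ δ p (f v) + δ p (f w)
            -- Only `b` is placed at distance 1 from `p`, so any two members give at least 1 + 2.
            far {v} {w} v∈ w∈ v≢w with toSum (v Fin.≟ b)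
            ... | inj₂ v≢b  = +-mono-≤ (f-deep v∈ v≢b) (f-pos w∈)
            ... | inj₁ refl = +-mono-≤ (f-pos v∈) (f-deep w∈ (≢-sym v≢w))
            fv∈ : ∀ {v} → v ∈ˡ vs → f v ∈ˡ map f vs ++ X
            fv∈ v∈ = ∈-++⁺ˡ (∈-map⁺ f v∈)
            dm : Dominates d (map f vs ++ X) S
            dm {s} s∈ with cover s∈
            ... | inj₁ refl = x , ∈-++⁺ʳ (map f vs) x∈ , p-dominated
            ... | inj₂ (v , rt , s∈B) with v Fin.≟ r | big? v
            ...   | yes refl | _ = x , ∈-++⁺ʳ (map f vs) x∈ , own-branch s∈B
            ...   | no v≢r | yes bg = f v , fv∈ (complete bg v≢r) , branch≤d rt s∈B (f∈ (complete bg v≢r))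
            ...   | no v≢r | no ¬bg = b , subst (_∈ˡ map f vs ++ X) f-b (fv∈ b∈) , ≤-trans (δ-tri s p b)
                    (≤-trans (≤-reflexive (trans (cong₂ _+_ (δ-sym s p) (proj₁ (proj₁ (h b∈)))) (+-comm (δ p s) 1))) (depth<d rt ¬bg s∈B))

          -- For `b` a neighbour whose branch has `d` vertices is preferred, as it is paid for
          -- anyway; otherwise any neighbour in `S` other than `r` fits in the budget of 1. If there
          -- is none, `X` already dominates `S`.
          extend-dist₂ : Extension d S J X
          extend-dist₂ with filter (λ v → ¬? (v Fin.≟ r)) bigs in eq
          ... | b ∷ bs = extend-via b (b ∷ bs) (here refl)
                (≤-trans (≤-trans (≤-reflexive (cong length (≡-sym eq))) (length-filter ≢r? bigs)) (m≤n⊔m 1 (length bigs)))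
                (λ v∈ → let (v∈bigs , v≢r) = ∈-filter⁻ ≢r? {xs = bigs} (subst (_ ∈ˡ_) (≡-sym eq) v∈)
                            bg = ∈bigs⁻ v∈bigs in proj₁ bg , v≢r , λ _ → bg)
                (λ bg v≢r → subst (_ ∈ˡ_) eq (∈-filter⁺ ≢r? (∈bigs⁺ bg) v≢r))
            where ≢r? = λ v → ¬? (v Fin.≟ r)
          ... | [] with Fin.any? (λ v → root? v ×-dec ¬? (v Fin.≟ r))
          ...   | yes (b , rb , b≢r) = extend-via b (b ∷ []) (here refl) (m≤m⊔n 1 (length bigs))
                (λ { (here refl) → rb , b≢r , λ b≢b → ⊥-elim (b≢b refl) })
                (λ bg v≢r → no-big bg v≢r)
            where
            no-big : ∀ {v} → Big v → v ≢ r → v ∈ˡ b ∷ []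
            no-big bg v≢r with subst (_ ∈ˡ_) eq (∈-filter⁺ (λ v → ¬? (v Fin.≟ r)) (∈bigs⁺ bg) v≢r)
            ... | ()
          ...   | no none = extension X pX dm (λ m → m) inj₁ (m≤n+m (length X) J)
            where
            dm : Dominates d X S
            dm {s} s∈ with cover s∈
            ... | inj₁ refl = x , x∈ , p-dominated
            ... | inj₂ (v , rt , s∈B) with v Fin.≟ r
            ...   | yes refl = x , x∈ , own-branch s∈B
            ...   | no v≢r   = ⊥-elim (none (v , rt , v≢r))

      -- With `r` the first step from `p` towards `z`, all of `X` lies beyond `r`. The cases are
      -- that `X` comes within 1 of `p`, only within 2, or stays at distance at least 3, when `p`
      -- itself can be added.
      cluster-extendable : Extendable d S J
      cluster-extendable {y} {z} y∈ z∉ yz X pX sX with δ-step {p} {z} (λ { refl → z∉ p∈ })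
      ... | r , pr , rz = cases
        where
        toward : ∀ {x} → x ∈ˡ X → Side r p x
        toward {x} x∈ with δ-edge pr x
        ... | inj₂ side = side
        -- The geodesic from `p` to `x` runs through `r` and `z`, so `r` cannot be the farther one.
        ... | inj₁ side = ⊥-elim (1+n≰n (≤-trans (s≤s (n≤1+n (δ p x))) (≤-trans (s≤s (≤-trans (≤-reflexive (≡-sym side)) (δ-tri r z x)))
                (≤-reflexive (≡-sym through)))))
          where
          through : δ p x ≡ suc (δ r z + δ z x)
          through = trans (δ-cross yz (cv y∈ z∉ yz p∈) (sX x∈))
            (trans (+-suc (δ y p) (δ z x)) (cong (_+ δ z x) (trans (≡-sym (cv y∈ z∉ yz p∈)) (trans (δ-sym z p) rz))))
        outside-S : ∀ {x} → x ∈ˡ X → x ∉ S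
        outside-S x∈ x∈S = Side-asym {z} {y} (sX x∈) (cv y∈ z∉ yz x∈S)
        cases : Extension d S J X
        cases with any? (λ x → δ p x ≤? 1) X | any? (λ x → δ p x ≤? 2) X
        ... | yes near | _ = let (x , x∈ , le) = find near in
          extend-dist₁ pr X pX toward
            -- Being beyond `r` and within 1 of `p` forces `x` to be `r`, and `X` avoids `S`.
            (λ r∈ → outside-S x∈ (subst (_∈ S) (δ-zero (n≤0⇒n≡0 (s≤s⁻¹ (≤-trans (≤-reflexive (≡-sym (toward x∈))) le)))) r∈)) x∈ le
        ... | no far | yes near = let (x , x∈ , le) = find near in
          extend-dist₂ pr X pX toward (λ y∈ → ≰⇒> (λ le → far (lose y∈ le))) x∈ le
        ... | no _ | no far = extension (p ∷ X) (packing-++ {p ∷ []} single pX (λ { (here refl) y∈ → ≰⇒> (λ le → far (lose y∈ le)) }))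
            (λ {s} s∈ → p , here refl , ≤-trans (≤-reflexive (δ-sym s p)) (depth≤d s∈))
            there (λ { (here refl) → inj₂ p∈ ; (there m) → inj₁ m }) (+-monoˡ-≤ (length X) (m≤m⊔n 1 (length bigs)))
          where
          single : Packing (p ∷ [])
          single (here refl) (here refl) p≢p = ⊥-elim (p≢p refl)

      cluster-good : Good d S
      -- With `q` equal to `J`, the centre alone meets the size bound of `own` with equality.
      cluster-good = good 1 J J ≤-refl J-sized (≤-reflexive (≡-sym (*-identityʳ J))) cluster-extendable
        (p ∷ [] , (λ { (here refl) (here refl) p≢p → ⊥-elim (p≢p refl) })
        , (λ {s} s∈ → p , here refl , ≤-trans (≤-reflexive (δ-sym s p)) (depth≤d s∈)) , (λ { (here refl) → p∈ }) , ≤-refl)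

    -- Cutting the tree into clusters.

    Centre : Subset n → Fin n → Set
    Centre S p = p ∈ S × ∀ v → δ p v ≡ 1 → v ∈ S → ∣ branch S p v ∣ ≤ d

    Splits : Subset n → Fin n → Fin n → Set
    Splits S u v = u ∈ S × v ∈ S × δ u v ≡ 1 × d < ∣ branch S v u ∣ × d < ∣ branch S u v ∣

    -- Walk into a branch with more than d vertices; as long as what is left behind is small, the branch ahead shrinks.
    centre-or-split : ∀ {S} → ∀ m p → p ∈ S →
      (∀ v → δ p v ≡ 1 → d < ∣ branch S p v ∣ → ∣ branch S p v ∣ ≤ m) →
      ∃ (Centre S) ⊎ ∃ λ u → ∃ (Splits S u)
    centre-or-split {S} m p p∈ bound
      with Fin.any? (λ v → (δ p v ≟ 1) ×-dec ((v ∈? S) ×-dec (d <? ∣ branch S p v ∣)))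
    ... | no none = inj₁ (p , p∈ , λ v pv v∈ → ≮⇒≥ (λ lt → none (v , pv , v∈ , lt)))
    ... | yes (v , pv , v∈ , lt) with d <? ∣ branch S v p ∣
    ...   | yes lt′ = inj₂ (p , v , p∈ , v∈ , pv , lt′ , lt)
    ...   | no ¬lt′ with m | bound v pv lt
    ...     | zero   | le = ⊥-elim (n≮0 (≤-trans lt le))
    ...     | suc m′ | le = centre-or-split m′ v v∈ shrinks
      where
      shrinks : ∀ w → δ v w ≡ 1 → d < ∣ branch S v w ∣ → ∣ branch S v w ∣ ≤ m′
      shrinks w vw lt″ = s≤s⁻¹ (≤-trans (p⊂q⇒∣p∣<∣q∣ (sub , v , ∈branch⁺ v∈ (side-self pv) , v∉)) le)
        where
        w≢p : p ≢ w
        -- The walk does not turn back, because the part behind has at most `d` vertices.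
        w≢p refl = ¬lt′ lt″
        sub : branch S v w ⊆ branch S p v
        sub x∈ = let (x∈S , side) = ∈branch⁻ {S} x∈ in
          ∈branch⁺ x∈S (opposite (δ-sym₁ pv) vw w≢p side)
        v∉ : v ∉ branch S v w
        v∉ v∈′ = 0≢1+n (trans (≡-sym (δ-refl v)) (proj₂ (∈branch⁻ {S} v∈′)))

    -- Induction on the size, bounded by `m`: a centre makes `S` one cluster, and a splitting edge
    -- leaves two smaller convex halves that are still large.
    large-convex-good : ∀ m {S} → ∣ S ∣ ≤ m → Convex S → d < ∣ S ∣ → Good d S
    large-convex-good zero     le cv lt = ⊥-elim (n≮0 (≤-trans lt le))
    large-convex-good (suc m) {S} le cv lt with nonempty? S
    ... | no empty = ⊥-elim (n≮0 (≤-trans lt (≤-trans (p⊆q⇒∣p∣≤∣q∣ {q = Subset.⊥} (λ x∈ → ⊥-elim (empty (_ , x∈)))) (≤-reflexive (∣⊥∣≡0 n)))))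
    ... | yes (p , p∈) with centre-or-split {S} ∣ S ∣ p p∈ (λ v _ _ → p⊆q⇒∣p∣≤∣q∣ (proj₁ ∘ ∈branch⁻ {S} {p} {v}))
    ...   | inj₁ (c , c∈ , small) = cluster-good cv c c∈ lt small
    ...   | inj₂ (u , v , u∈ , v∈ , uv , ltu , ltv) =
      glue cv u∈ v∈ uv
        (large-convex-good m (s≤s⁻¹ (≤-trans (m<m+n _ (≤-trans (s≤s z≤n) ltv)) both)) (branch-convex cv (δ-sym₁ uv)) ltu)
        (large-convex-good m (s≤s⁻¹ (≤-trans (m<n+m _ (≤-trans (s≤s z≤n) ltu)) both)) (branch-convex cv uv) ltv)
      where
      both : ∣ branch S v u ∣ + ∣ branch S u v ∣ ≤ suc m
      both = ≤-trans (branch-sizes {S} {u} {v}) le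

  -- Arithmetic of the bound.

  4ab≤[a+b]² : ∀ a b → 4 * (a * b) ≤ (a + b) * (a + b)
  4ab≤[a+b]² a b with ≤-total a b
  ... | inj₁ a≤b with m≤n⇒∃[o]m+o≡n a≤b
  -- The surplus `c * c` is the squared difference of `a` and `b`.
  ...   | c , refl = ≤-trans (m≤m+n _ (c * c)) (≤-reflexive (solve 2 (λ a c →
            con 4 :* (a :* (a :+ c)) :+ c :* c := (a :+ (a :+ c)) :* (a :+ (a :+ c))) refl a c))
  4ab≤[a+b]² a b | inj₂ b≤a with m≤n⇒∃[o]m+o≡n b≤a
  ...   | c , refl = ≤-trans (m≤m+n _ (c * c)) (≤-reflexive (solve 2 (λ b c →
            con 4 :* ((b :+ c) :* b) :+ c :* c := ((b :+ c) :+ b) :* ((b :+ c) :+ b)) refl b c))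

  -- `2 + t` stands for n + d + 1 - d γ and `k` for K - 1. Adding `4 * d + 4` to both sides
  -- completes `4 * n` to a multiple of the left side of the equation.
  square-bound : ∀ d n γ q k t → γ ≤ q * k + 1 → d * q + k ≤ t → n + d + 1 ≡ d * γ + (2 + t) → 4 * n ≤ (2 + t) * (2 + t)
  square-bound d n γ q k t γ≤ ≤t eq = +-cancelʳ-≤ (4 * d + 4) _ _ (begin
      4 * n + (4 * d + 4)             ≡⟨ solve 2 (λ n d → con 4 :* n :+ (con 4 :* d :+ con 4) := con 4 :* (n :+ d :+ con 1)) refl n d ⟩
      4 * (n + d + 1)                 ≡⟨ cong (4 *_) eq ⟩
      4 * (d * γ + (2 + t))           ≤⟨ *-monoʳ-≤ 4 (+-monoˡ-≤ (2 + t) (*-monoʳ-≤ d γ≤)) ⟩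
      4 * (d * (q * k + 1) + (2 + t)) ≡⟨ solve 4 (λ d q k t → con 4 :* (d :* (q :* k :+ con 1) :+ (con 2 :+ t)) :=
                                           con 4 :* ((d :* q) :* k) :+ (con 4 :* t :+ con 4 :+ (con 4 :* d :+ con 4))) refl d q k t ⟩
      4 * ((d * q) * k) + (4 * t + 4 + (4 * d + 4))
        ≤⟨ +-monoˡ-≤ _ (≤-trans (4ab≤[a+b]² (d * q) k) (*-mono-≤ ≤t ≤t)) ⟩
      t * t + (4 * t + 4 + (4 * d + 4)) ≡⟨ solve 2 (λ d t → t :* t :+ (con 4 :* t :+ con 4 :+ (con 4 :* d :+ con 4)) :=
                                           (con 2 :+ t) :* (con 2 :+ t) :+ (con 4 :* d :+ con 4)) refl d t ⟩
      (2 + t) * (2 + t) + (4 * d + 4) ∎)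
    where open ≤-Reasoning

  -- From packings to the domination number.

  subset-of-list : ∀ {n} (S : Subset n) L → (∀ {x} → x ∈ S → x ∈ˡ L) → ∣ S ∣ ≤ length L
  subset-of-list {n} S [] sub = ≤-trans (p⊆q⇒∣p∣≤∣q∣ {q = Subset.⊥} λ x∈ → case sub x∈ of λ ()) (≤-reflexive (∣⊥∣≡0 n))
  subset-of-list S (x ∷ L) sub = begin
      ∣ S ∣                         ≡⟨ ∣p∩q∣+∣p─q∣≡∣p∣ S ⁅ x ⁆ ⟨
      ∣ S ∩ ⁅ x ⁆ ∣ + ∣ S - x ∣     ≤⟨ +-mono-≤ (≤-trans (∣p∩q∣≤∣q∣ S ⁅ x ⁆) (≤-reflexive (∣⁅x⁆∣≡1 x))) (subset-of-list (S - x) L sub′) ⟩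
      suc (length L)                ∎
    where
    open ≤-Reasoning
    sub′ : ∀ {y} → y ∈ S - x → y ∈ˡ L
    sub′ {y} y∈ with sub (p─q⊆p S ⁅ x ⁆ y∈)
    ... | there m   = m
    -- If `x` were in `S - x`, removing it again would shrink a set that this removal leaves
    -- unchanged.
    ... | here refl = ⊥-elim (<-irrefl refl (≤-trans (x∈p⇒∣p-x∣<∣p∣ y∈) (≤-reflexive (cong ∣_∣ (≡-sym (p─q─q≡p─q S ⁅ x ⁆))))))

  module _ {n : ℕ} (T : Graph n) (tree : IsTree T) where
    open import Data.List.Membership.DecPropositional (Fin._≟_ {n}) using () renaming (_∈?_ to _∈ˡ?_)
    open FromTree T (proj₁ (proj₂ tree)) (proj₂ (proj₂ tree))
    open Tree metric

    -- Repetitions in `L` do no harm: the set of its entries has at most `length L` elements.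
    gamma≤length : ∀ {d γ} → IsGammaD2 T d γ → ∀ L → Packing L → Dominates d L Subset.⊤ → γ ≤ length L
    gamma≤length {d} (_ , minimal) L pack dm =
        ≤-trans (minimal X (dominating , packed)) (subset-of-list X L (∈-comprehension⁻ (_∈ˡ? L)))
      where
      X = comprehension (_∈ˡ? L)
      dominating : ∀ v → v ∉ X → ∃ λ x → x ∈ X × DistLE T v x d
      dominating v _ = let (x , x∈ , le) = dm (∈⊤ {x = v}) in x , ∈-comprehension⁺ (_∈ˡ? L) x∈ , geo v x , le
      packed : ∀ x y → x ∈ X → y ∈ X → ¬ x ≡ y → DistGE T x y 3
      packed x y x∈ y∈ x≢y w = ≤-trans (pack (∈-comprehension⁻ (_∈ˡ? L) x∈) (∈-comprehension⁻ (_∈ˡ? L) y∈) x≢y) (dist-min w)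

    gamma-bound : ∀ {d γ} → 2 ≤ d → IsGammaD2 T d γ →
      ∃ λ q → ∃ λ k → γ ≤ q * k + 1 × d * γ + (2 + (d * q + k)) ≤ n + d + 1
    gamma-bound {d} {γ} 2≤d isγ with d <? n
    -- When n ≤ d, any single vertex dominates the tree, and `q` = `k` = 0 will do.
    ... | no d≮n = 0 , 0 , γ≤1 , (begin
        d * γ + (2 + (d * 0 + 0)) ≤⟨ +-mono-≤ (*-monoʳ-≤ d γ≤1) (≤-reflexive (cong (λ m → 2 + (m + 0)) (*-zeroʳ d))) ⟩
        d * 1 + 2                 ≤⟨ +-monoʳ-≤ (d * 1) (+-monoˡ-≤ 1 (proj₁ tree)) ⟩
        d * 1 + (n + 1)           ≡⟨ solve 2 (λ d n → d :* con 1 :+ (n :+ con 1) := n :+ d :+ con 1) refl d n ⟩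
        n + d + 1                 ∎)
      where
      open ≤-Reasoning
      c : Fin n
      c = Fin.fromℕ< (proj₁ tree)
      γ≤1 : γ ≤ 1
      γ≤1 = gamma≤length isγ (c ∷ []) (λ { (here refl) (here refl) c≢c → ⊥-elim (c≢c refl) })
        λ {s} s∈ → c , here refl , ≤-trans (<⇒≤ (convex-diam full-convex s∈ ∈⊤)) (≤-trans (∣p∣≤n Subset.⊤) (≮⇒≥ d≮n))
    ... | yes d<n with large-convex-good 2≤d n (∣p∣≤n Subset.⊤) full-convex (subst (d <_) (≡-sym (∣⊤∣≡n n)) d<n)
      where open Cluster metric
    ...   | good (suc k) J q _ sized J≤qK _ (L , pack , dm , _ , small) = q , k ,
        +-cancelʳ-≤ q γ (q * k + 1) (begin
          γ + q                         ≤⟨ γ+q≤1+J ⟩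
          suc J                         ≤⟨ s≤s J≤qK ⟩
          suc (q * suc k)               ≡⟨ solve 2 (λ q k → con 1 :+ q :* (con 1 :+ k) := q :* k :+ con 1 :+ q) refl q k ⟩
          q * k + 1 + q                 ∎) ,
        (begin
          d * γ + (2 + (d * q + k))     ≡⟨ solve 4 (λ d γ q k → d :* γ :+ (con 2 :+ (d :* q :+ k)) := d :* (γ :+ q) :+ (con 2 :+ k)) refl d γ q k ⟩
          d * (γ + q) + (2 + k)         ≤⟨ +-monoˡ-≤ (2 + k) (*-monoʳ-≤ d γ+q≤1+J) ⟩
          d * suc J + (2 + k)           ≡⟨ solve 3 (λ d J k → d :* (con 1 :+ J) :+ (con 2 :+ k) := d :* J :+ (con 1 :+ k) :+ d :+ con 1) refl d J k ⟩
          d * J + suc k + d + 1         ≤⟨ +-monoˡ-≤ 1 (+-monoˡ-≤ d (≤-trans sized (∣p∣≤n Subset.⊤))) ⟩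
          n + d + 1                     ∎)
      where
      open ≤-Reasoning
      γ+q≤1+J : γ + q ≤ suc J
      γ+q≤1+J = ≤-trans (+-monoˡ-≤ q (gamma≤length isγ L pack dm)) small

-- Transfer to the integers.

open Combinatorics

open import Data.Integer using (ℤ; +_; _+_; _-_; _*_; +≤+) renaming (_≤_ to _≤ℤ_)
import Data.Integer.Properties as ℤ

[m+n]-m≡n : ∀ m n → + (m ℕ.+ n) - + m ≡ + n
[m+n]-m≡n m n = trans (ℤ.[+m]-[+n]≡m⊖n (m ℕ.+ n) m) (trans (ℤ.⊖-≥ (m≤m+n m n)) (cong +_ (m+n∸m≡n m n)))

-- The two conjuncts together say 2√n ≤ n + d + 1 - d γ without real numbers: the right side is
-- nonnegative and its square is at least 4 n.
integer-bound : ∀ d n γ q k → γ ≤ q ℕ.* k ℕ.+ 1 → d ℕ.* γ ℕ.+ (2 ℕ.+ (d ℕ.* q ℕ.+ k)) ≤ n ℕ.+ d ℕ.+ 1 →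
    (+ 0 ≤ℤ (+ n + + d + + 1 - + d * + γ)) ×
    (+ (4 ℕ.* n) ≤ℤ (+ n + + d + + 1 - + d * + γ) * (+ n + + d + + 1 - + d * + γ))
integer-bound d n γ q k γ≤ le with m≤n⇒∃[o]m+o≡n le
... | c , eq = subst (λ m → (+ 0 ≤ℤ m) × (+ (4 ℕ.* n) ≤ℤ m * m)) (≡-sym value)
      (+≤+ z≤n , subst (+ (4 ℕ.* n) ≤ℤ_) (ℤ.pos-* (2 ℕ.+ t) (2 ℕ.+ t)) (+≤+ (square-bound d n γ q k t γ≤ (m≤m+n _ c) eq′)))
  where
  t = d ℕ.* q ℕ.+ k ℕ.+ c
  eq′ : n ℕ.+ d ℕ.+ 1 ≡ d ℕ.* γ ℕ.+ (2 ℕ.+ t)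
  eq′ = trans (≡-sym eq) (+-assoc (d ℕ.* γ) (2 ℕ.+ (d ℕ.* q ℕ.+ k)) c)
  value : + n + + d + + 1 - + d * + γ ≡ + (2 ℕ.+ t)
  value = trans (cong₂ _-_ (cong +_ eq′) (≡-sym (ℤ.pos-* d γ))) ([m+n]-m≡n (d ℕ.* γ) (2 ℕ.+ t))

theorem1p5 : (d n : ℕ) → 2 ≤ d → (T : Graph n) → IsTree T →
    (γ : ℕ) → IsGammaD2 T d γ →
    (+ 0 ≤ℤ (+ n + + d + + 1 - + d * + γ)) ×
    (+ (4 Data.Nat.* n) ≤ℤ (+ n + + d + + 1 - + d * + γ) * (+ n + + d + + 1 - + d * + γ))
theorem1p5 d n 2≤d T tree γ isγ with gamma-bound T tree 2≤d isγ
... | q , k , γ≤ , le = integer-bound d n γ q k γ≤ le
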